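{- For every edge-colored hypergraph $H=(V,E,C,\ell)$ with weights $w_e \ge 0$, the optimal value of the node-weighted multiway cut LP relaxation on the reduced graph $G(H)$ is at most the optimal value of the \textsc{MinECC} LP relaxation on $H$. Moreover, the inequality can be strict: for $C=\{1,2,3\}$ and $H$ the star graph with center $v_0$, leaves $v_1,v_2,v_3$ and unit-weight edges $e_i=\{v_0,v_i\}$ of color $i$ ($i=1,2,3$), the \textsc{MinECC} LP relaxation has optimal value $2$ while the node-weighted multiway cut LP relaxation on $G(H)$ has optimal value $\frac32$.
   Context: An edge-colored hypergraph is $H=(V,E,C,\ell)$ with finite node set $V$, a multiset $E$ of nonempty subsets of $V$ (edges), a color set $C=[k]$, a map $\ell\colon E\to C$, and weights $w_e\ge 0$. The \textsc{MinECC} LP relaxation has variables $x_v^i$ ($v\in V,i\in C$), $x_e$ ($e\in E$) and is: minimize $\sum_{e} w_e x_e$ subject to $\sum_{i=1}^k x_v^i = k-1$ for all $v$; $x_e\ge x_v^{\ell(e)}$ for all $e$ and $v\in e$; $0\le x_v^i\le 1$; $0\le x_e\le 1$. The reduced graph $G(H)=(\hat V,\hat E)$ has node set $\hat V = T\cup V\cup V_E$, where $T=\{t_1,\dots,t_k\}$ are terminal nodes (one per color) and $V_E=\{v_e: e\in E\}$ has one node per edge of $H$; its edge set consists of $(v,v_e)$ for every $e\in E$ and $v\in e$, and $(t_{\ell(e)},v_e)$ for every $e\in E$. Nodes $v_e$ have weight $w_e$; nodes in $V\cup T$ have infinite weight. The node-weighted multiway cut LP relaxation on $G(H)$ has variables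 $d_u\ge 0$ for $u\in\hat V$ and $y_u^i$ for $u\in \hat V$, $i\in[k]$, with $d_u=0$ for all $u\in V\cup T$ (infinite-weight nodes), and is: minimize $\sum_{e\in E} w_e d_{v_e}$ subject to $y_b^i \le y_a^i + d_b$ and $y_a^i\le y_b^i + d_a$ for every edge $(a,b)\in\hat E$ and every $i\in[k]$; $y_{t_i}^i=0$ for all $i$; $y_{t_i}^j\ge 1$ for all $i\neq j$. (Equivalently: minimize $\sum_e w_e d_{v_e}$ subject to $d\ge 0$, $d=0$ on $V\cup T$, and $\sum_{u\in P} d_u\ge 1$ for every path $P$ in $G(H)$ between two distinct terminals.) -}

module Defs where

open import Level using (Level; _⊔_) renaming (suc to lsuc)
open import Algebra.Bundles using (CommutativeRing)
import Algebra.Definitions.RawMonoid as RawMonoidDefinitions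
import Algebra.Properties.Ring as RingProperties
open import Data.Nat.Base using (ℕ)
open import Data.Fin.Base using (Fin; zero; suc)
open import Data.Fin.Subset using (Subset; _∈_; Nonempty; ⁅_⁆; _∪_)
open import Data.Fin.Subset.Properties using (x∈⁅x⁆; p⊆p∪q)
open import Data.Product.Base using (∃-syntax; _×_; _,_; proj₁)
open import Data.Sum.Base using (inj₁; inj₂)
open import Relation.Binary.Core using (Rel)
open import Relation.Binary.Structures using (IsTotalOrder)
import Relation.Binary.Construct.NonStrictToStrict as NonStrictToStrict
open import Relation.Binary.PropositionalEquality using (_≢_)
open import Relation.Nullary.Negation using (¬_)

-- The standard library has neither the reals nor ordered fields.  Scalars are
-- taken in an arbitrary totally ordered field, which covers ℚ and ℝ alike.
record OrderedField (c ℓ₁ ℓ₂ : Level) : Set (lsuc (c ⊔ ℓ₁ ⊔ ℓ₂)) where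
  infix 4 _≤_
  field
    commutativeRing : CommutativeRing c ℓ₁
  open CommutativeRing commutativeRing public
  field
    _≤_          : Rel Carrier ℓ₂
    isTotalOrder : IsTotalOrder _≈_ _≤_
    0≉1          : ¬ (0# ≈ 1#)
    inverse      : ∀ x → ¬ (x ≈ 0#) → ∃[ y ] x * y ≈ 1#
    +-monoˡ-≤    : ∀ z {x y} → x ≤ y → x + z ≤ y + z
    *-nonNeg     : ∀ {x y} → 0# ≤ x → 0# ≤ y → 0# ≤ x * y

  module ≤ = IsTotalOrder isTotalOrder

  open NonStrictToStrict _≈_ _≤_ public using (_<_)
  open RawMonoidDefinitions +-rawMonoid public using (sum) renaming (_×_ to _·_)

  fromℕ : ℕ → Carrier
  fromℕ n = n · 1#

  0≤1 : 0# ≤ 1#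
  0≤1 with ≤.total 0# 1#
  ... | inj₁ p = p
  ... | inj₂ 1≤0 = ≤.≤-respʳ-≈ -1*-1≈1 (*-nonNeg 0≤-1 0≤-1)
    where
    open RingProperties ring using (-1*x≈-x; -‿involutive)
    0≤-1 : 0# ≤ - 1#
    0≤-1 = ≤.≤-respˡ-≈ (-‿inverseʳ 1#) (≤.≤-respʳ-≈ (+-identityˡ (- 1#)) (+-monoˡ-≤ (- 1#) 1≤0))
    -1*-1≈1 : - 1# * - 1# ≈ 1#
    -1*-1≈1 = trans (-1*x≈-x (- 1#)) (-‿involutive 1#)

  2≉0 : ¬ (fromℕ 2 ≈ 0#)
  2≉0 2≈0 = 0≉1 (≤.antisym 0≤1 (≤.≤-respʳ-≈ 2≈0 1≤2))
    where
    1≤2 : 1# ≤ fromℕ 2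
    1≤2 = ≤.≤-respˡ-≈ (+-identityˡ 1#) (≤.≤-respʳ-≈ (+-congˡ (sym (+-identityʳ 1#))) (+-monoˡ-≤ 1# 0≤1))

  ½ : Carrier
  ½ = proj₁ (inverse (fromℕ 2) 2≉0)

module _ {c ℓ₁ ℓ₂ : Level} (K : OrderedField c ℓ₁ ℓ₂) where
  open OrderedField K hiding (zero)

  record MinimizationProblem : Set (lsuc (c ⊔ ℓ₁ ⊔ ℓ₂)) where
    field
      Solution  : Set c
      Feasible  : Solution → Set (c ⊔ ℓ₁ ⊔ ℓ₂)
      objective : Solution → Carrier

  record IsOptimalValue (P : MinimizationProblem) (v : Carrier) : Set (c ⊔ ℓ₁ ⊔ ℓ₂) where
    open MinimizationProblem P
    field
      attained   : ∃[ s ] Feasible s × objective s ≈ v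
      lowerBound : ∀ s → Feasible s → v ≤ objective s

  -- V = Fin ∣V∣ and C = Fin k.  Edges are indexed by Fin ∣E∣, so that distinct
  -- edges may be equal as node sets (E is a multiset).
  record Hypergraph : Set (c ⊔ ℓ₂) where
    field
      ∣V∣ ∣E∣ k     : ℕ
      edge          : Fin ∣E∣ → Subset ∣V∣
      edge-nonempty : ∀ e → Nonempty (edge e)
      colour        : Fin ∣E∣ → Fin k
      weight        : Fin ∣E∣ → Carrier
      weight-nonNeg : ∀ e → 0# ≤ weight e

  module _ (H : Hypergraph) where
    open Hypergraph H

    record MinECCSolution : Set c where
      field
        xᵥ : Fin ∣V∣ → Fin k → Carrier
        xₑ : Fin ∣E∣ → Carrier

    record MinECCFeasible (s : MinECCSolution) : Set (c ⊔ ℓ₁ ⊔ ℓ₂) where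
      open MinECCSolution s
      field
        node-sum  : ∀ v → sum (λ i → xᵥ v i) ≈ fromℕ k - 1#
        edge-node : ∀ e v → v ∈ edge e → xᵥ v (colour e) ≤ xₑ e
        0≤xᵥ      : ∀ v i → 0# ≤ xᵥ v i
        xᵥ≤1      : ∀ v i → xᵥ v i ≤ 1#
        0≤xₑ      : ∀ e → 0# ≤ xₑ e
        xₑ≤1      : ∀ e → xₑ e ≤ 1#

    MinECC-LP : MinimizationProblem
    MinECC-LP = record
      { Solution  = MinECCSolution
      ; Feasible  = MinECCFeasible
      ; objective = λ s → sum (λ e → weight e * MinECCSolution.xₑ s e)
      }

    data ReducedNode : Set where
      terminal : Fin k → ReducedNode
      node     : Fin ∣V∣ → ReducedNode
      edgeNode : Fin ∣E∣ → ReducedNode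

    -- Each undirected edge of G(H) is listed in one orientation.
    data ReducedEdge : ReducedNode → ReducedNode → Set where
      node-edge     : ∀ e v → v ∈ edge e → ReducedEdge (node v) (edgeNode e)
      terminal-edge : ∀ e → ReducedEdge (terminal (colour e)) (edgeNode e)

    record MultiwayCutSolution : Set c where
      field
        d : ReducedNode → Carrier
        y : ReducedNode → Fin k → Carrier

    -- The infinite weights of T ∪ V are encoded by d-terminal and d-node.
    record MultiwayCutFeasible (s : MultiwayCutSolution) : Set (c ⊔ ℓ₁ ⊔ ℓ₂) where
      open MultiwayCutSolution s
      field
        d-nonNeg       : ∀ u → 0# ≤ d u
        d-terminal     : ∀ i → d (terminal i) ≈ 0#
        d-node         : ∀ v → d (node v) ≈ 0#
        forward        : ∀ a b → ReducedEdge a b → ∀ i → y b i ≤ y a i + d b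
        backward       : ∀ a b → ReducedEdge a b → ∀ i → y a i ≤ y b i + d a
        own-terminal   : ∀ i → y (terminal i) i ≈ 0#
        other-terminal : ∀ i j → i ≢ j → 1# ≤ y (terminal i) j

    MultiwayCut-LP : MinimizationProblem
    MultiwayCut-LP = record
      { Solution  = MultiwayCutSolution
      ; Feasible  = MultiwayCutFeasible
      ; objective = λ s → sum (λ e → weight e * MultiwayCutSolution.d s (edgeNode e))
      }

  -- Node zero is the centre v₀; the leaf of the i-th edge is suc i.
  star : Hypergraph
  star = record
    { ∣V∣           = 4
    ; ∣E∣           = 3
    ; k             = 3
    ; edge          = λ i → ⁅ zero ⁆ ∪ ⁅ suc i ⁆
    ; edge-nonempty = λ i → zero , p⊆p∪q ⁅ suc i ⁆ (x∈⁅x⁆ zero)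
    ; colour        = λ i → i
    ; weight        = λ _ → 1#
    ; weight-nonNeg = λ _ → 0≤1
    }

{-# OPTIONS --safe #-}

-- A MinECC solution x yields a multiway cut of the same cost: take d(vₑ) = xₑ
-- with labels y(v) = xᵥ, y(tᵢ)ʲ = [i ≠ j], and
-- y(vₑ)ⁱ = xₑ or 1 according to whether i is the colour of e.  The only
-- constraint that is not immediate is 1 ≤ xᵥⁱ + xₑ for i ≠ ℓ(e); it holds since
-- the numbers 1 - xᵥⁱ are nonnegative with sum 1, so xᵥⁱ + xᵥʲ ≥ 1 for i ≠ j.
-- On the star, the labels above with x = ½ everywhere still form a multiway cut,
-- of cost 3/2, although they violate the node sums of MinECC.
module Submission where

open import Level using (Level)
import Algebra.Properties.CommutativeMonoid.Sum as CommutativeMonoidSum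
import Algebra.Properties.Group as GroupProperties
import Algebra.Solver.Ring.NaturalCoefficients.Default as SemiringSolver
open import Data.Bool.Base using (if_then_else_)
open import Data.Empty using (⊥-elim)
open import Data.Fin.Base using (Fin; zero; suc; punchIn; punchOut)
open import Data.Fin.Properties using (_≟_; punchIn-punchOut)
open import Data.Fin.Subset using (_∈_; ⁅_⁆)
open import Data.Fin.Subset.Properties using (x∈⁅x⁆; x∈⁅y⁆⇒x≡y; x∈p∪q⁻; p⊆p∪q)
open import Data.Nat.Base using (zero; suc)
open import Data.Product.Base using (_×_; _,_; proj₂)
open import Data.Sum.Base using (inj₁; inj₂)
open import Data.Vec.Functional using (removeAt)
open import Function.Base using (_∘_)
open import Relation.Binary.Bundles using (Poset)
import Relation.Binary.Reasoning.PartialOrder as PartialOrderReasoning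
open import Relation.Binary.PropositionalEquality as ≡ using (_≡_; _≢_)
open import Relation.Nullary.Decidable.Core using (does; yes; no)
open import Relation.Nullary.Negation using (¬_)
open import Defs

module _ {c ℓ₁ ℓ₂ : Level} (K : OrderedField c ℓ₁ ℓ₂) where
  open OrderedField K hiding (zero)
  open CommutativeMonoidSum +-commutativeMonoid using (sum-remove; sum-cong-≋)
  open GroupProperties +-group using (∙-cancelˡ; x≈z//y)
  open SemiringSolver commutativeSemiring using (solve; _:=_; _:+_; _:*_; con)

  -- Order arithmetic and finite sums

  poset : Poset c ℓ₁ ℓ₂
  poset = record { isPartialOrder = ≤.isPartialOrder }

  open PartialOrderReasoning poset

  +-monoʳ-≤ : ∀ z {x y} → x ≤ y → z + x ≤ z + y
  +-monoʳ-≤ z {x} {y} x≤y = begin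
    z + x ≈⟨ +-comm z x ⟩
    x + z ≤⟨ +-monoˡ-≤ z x≤y ⟩
    y + z ≈⟨ +-comm y z ⟩
    z + y ∎

  +-mono-≤ : ∀ {x y u v} → x ≤ y → u ≤ v → x + u ≤ y + v
  +-mono-≤ {y = y} {u} x≤y u≤v = ≤.trans (+-monoˡ-≤ u x≤y) (+-monoʳ-≤ y u≤v)

  +-cancelʳ-≤ : ∀ z {x y} → x + z ≤ y + z → x ≤ y
  +-cancelʳ-≤ z {x} {y} x+z≤y+z = begin
    x             ≈⟨ cancel x ⟨
    x + z + - z   ≤⟨ +-monoˡ-≤ (- z) x+z≤y+z ⟩
    y + z + - z   ≈⟨ cancel y ⟩
    y             ∎
    where
    cancel : ∀ w → w + z + - z ≈ w
    cancel w = trans (+-assoc w z (- z)) (trans (+-congˡ (-‿inverseʳ z)) (+-identityʳ w))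

  x≤x+y : ∀ x {y} → 0# ≤ y → x ≤ x + y
  x≤x+y x {y} 0≤y = ≤.trans (≤.reflexive (sym (+-identityʳ x))) (+-monoʳ-≤ x 0≤y)

  x≤y+x : ∀ x {y} → 0# ≤ y → x ≤ y + x
  x≤y+x x {y} 0≤y = ≤.trans (x≤x+y x 0≤y) (≤.reflexive (+-comm x y))

  *-monoʳ-≤-nonNeg : ∀ {z x y} → 0# ≤ z → x ≤ y → x * z ≤ y * z
  *-monoʳ-≤-nonNeg {z} {x} {y} 0≤z x≤y = begin
    x * z                   ≤⟨ x≤y+x (x * z) (*-nonNeg 0≤y-x 0≤z) ⟩
    (y - x) * z + x * z     ≈⟨ distribʳ z (y - x) x ⟨
    (y - x + x) * z         ≈⟨ *-congʳ y-x+x≈y ⟩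
    y * z                   ∎
    where
    0≤y-x : 0# ≤ y - x
    0≤y-x = ≤.≤-respˡ-≈ (-‿inverseʳ x) (+-monoˡ-≤ (- x) x≤y)
    y-x+x≈y : y - x + x ≈ y
    y-x+x≈y = trans (+-assoc y (- x) x) (trans (+-congˡ (-‿inverseˡ x)) (+-identityʳ y))

  sum-mono-≤ : ∀ {n} {f g : Fin n → Carrier} → (∀ i → f i ≤ g i) → sum f ≤ sum g
  sum-mono-≤ {zero}  f≤g = ≤.refl
  sum-mono-≤ {suc n} f≤g = +-mono-≤ (f≤g zero) (sum-mono-≤ (f≤g ∘ suc))

  sum-≤1 : ∀ {n} {f : Fin n → Carrier} → (∀ i → f i ≤ 1#) → sum f ≤ fromℕ n
  sum-≤1 {zero}  f≤1 = ≤.refl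
  sum-≤1 {suc n} f≤1 = +-mono-≤ (f≤1 zero) (sum-≤1 (f≤1 ∘ suc))

  -- Apart from `f i` and `f j` there are k - 2 entries, each at most 1, so these two must supply at
  -- least (k - 1) - (k - 2) = 1 of the total.
  sum≈k-1⇒1≤pair : ∀ {k} {f : Fin k → Carrier} → (∀ i → f i ≤ 1#) → sum f ≈ fromℕ k - 1# →
                   ∀ {i j} → i ≢ j → 1# ≤ f i + f j
  sum≈k-1⇒1≤pair {suc zero} f≤1 sum≈ {i} i≢j with () ← punchOut i≢j
  -- With n = k - 2, the amount to cancel is `fromℕ n` for the remaining entries plus the 1
  -- subtracted in `fromℕ k - 1#`.
  sum≈k-1⇒1≤pair {suc (suc n)} {f} f≤1 sum≈ {i} {j} i≢j = +-cancelʳ-≤ (1# + fromℕ n) (begin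
    1# + (1# + fromℕ n)               ≈⟨ +-identityʳ _ ⟨
    fromℕ k + 0#                      ≈⟨ +-congˡ (-‿inverseˡ 1#) ⟨
    fromℕ k + (- 1# + 1#)             ≈⟨ +-assoc _ _ _ ⟨
    fromℕ k - 1# + 1#                 ≈⟨ +-congʳ sum≈ ⟨
    sum f + 1#                        ≈⟨ +-congʳ split ⟩
    f i + (f j + sum rest) + 1#       ≤⟨ +-monoˡ-≤ 1# (+-monoʳ-≤ (f i) (+-monoʳ-≤ (f j) (sum-≤1 rest≤1))) ⟩
    f i + (f j + fromℕ n) + 1#        ≈⟨ solve 4 (λ a b s o → a :+ (b :+ s) :+ o := a :+ b :+ (o :+ s))
                                               refl (f i) (f j) (fromℕ n) 1# ⟩
    f i + f j + (1# + fromℕ n)        ∎)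
    where
    k = suc (suc n)
    -- The position of `j` once entry `i` has been removed.
    j′ = punchOut i≢j
    rest = removeAt (removeAt f i) j′
    rest≤1 : ∀ l → rest l ≤ 1#
    rest≤1 l = f≤1 (punchIn i (punchIn j′ l))
    split : sum f ≈ f i + (f j + sum rest)
    split = trans (sum-remove {i = i} f) (+-congˡ (trans (sum-remove {i = j′} (removeAt f i))
              (+-congʳ (reflexive (≡.cong f (punchIn-punchOut i≢j))))))

  -- The constants one half and three halves

  ½+½≈1 : ½ + ½ ≈ 1#
  ½+½≈1 = begin-equality
    ½ + ½             ≈⟨ +-cong (*-identityˡ ½) (*-identityˡ ½) ⟨
    1# * ½ + 1# * ½   ≈⟨ solve 2 (λ o h → o :* h :+ o :* h := (o :+ (o :+ con 0)) :* h) refl 1# ½ ⟩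
    fromℕ 2 * ½       ≈⟨ proj₂ (inverse (fromℕ 2) 2≉0) ⟩
    1#                ∎

  -- `½` is given only as an inverse of 2, so its sign comes from totality: if `½ ≤ 0#`, doubling
  -- gives `1# ≤ 0#`.
  0≤½ : 0# ≤ ½
  0≤½ with ≤.total 0# ½
  ... | inj₁ 0≤½ = 0≤½
  ... | inj₂ ½≤0 = ⊥-elim (0≉1 (≤.antisym 0≤1 (begin
    1#        ≈⟨ ½+½≈1 ⟨
    ½ + ½     ≤⟨ +-mono-≤ ½≤0 ½≤0 ⟩
    0# + 0#   ≈⟨ +-identityʳ 0# ⟩
    0#        ∎)))

  ½≤1 : ½ ≤ 1#
  ½≤1 = ≤.trans (x≤x+y ½ 0≤½) (≤.reflexive ½+½≈1)

  ½≉1 : ¬ (½ ≈ 1#)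
  ½≉1 ½≈1 = 0≉1 (sym (∙-cancelˡ 1# 1# 0# (begin-equality
    1# + 1#   ≈⟨ +-cong ½≈1 ½≈1 ⟨
    ½ + ½     ≈⟨ ½+½≈1 ⟩
    1#        ≈⟨ +-identityʳ 1# ⟨
    1# + 0#   ∎)))

  3*½≈1+½ : fromℕ 3 * ½ ≈ 1# + ½
  3*½≈1+½ = begin-equality
    fromℕ 3 * ½                  ≈⟨ solve 2 (λ o h → (o :+ (o :+ (o :+ con 0))) :* h
                                                     := o :* h :+ o :* h :+ o :* h) refl 1# ½ ⟩
    1# * ½ + 1# * ½ + 1# * ½     ≈⟨ +-cong (+-cong (*-identityˡ ½) (*-identityˡ ½)) (*-identityˡ ½) ⟩
    ½ + ½ + ½                    ≈⟨ +-congʳ ½+½≈1 ⟩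
    1# + ½                       ∎

  2≈1+1 : fromℕ 2 ≈ 1# + 1#
  2≈1+1 = +-congˡ (+-identityʳ 1#)

  3*½<2 : fromℕ 3 * ½ < fromℕ 2
  -- The strict order is `≤` together with `≉`. Equality would read 1 + ½ = 1 + 1 and cancel to ½ =
  -- 1.
  3*½<2 = 3*½≤2 , λ 3*½≈2 → ½≉1 (∙-cancelˡ 1# ½ 1# (trans (sym 3*½≈1+½) (trans 3*½≈2 2≈1+1)))
    where
    3*½≤2 : fromℕ 3 * ½ ≤ fromℕ 2
    3*½≤2 = begin
      fromℕ 3 * ½   ≈⟨ 3*½≈1+½ ⟩
      1# + ½        ≤⟨ +-monoʳ-≤ 1# ½≤1 ⟩
      1# + 1#       ≈⟨ 2≈1+1 ⟨
      fromℕ 2       ∎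

  -- Labels equal to one off a single colour

  -- With `a = 0#` this is the label of terminal `i`, and also the MinECC vector of a node assigned
  -- colour `i`; with `a = xₑ e` and `i = colour e` it is the label of an edge node.
  oneExcept : ∀ {k} → Carrier → Fin k → Fin k → Carrier
  oneExcept a i j = if does (i ≟ j) then a else 1#

  0≤oneExcept : ∀ {k a} → 0# ≤ a → (i j : Fin k) → 0# ≤ oneExcept a i j
  0≤oneExcept 0≤a i j with i ≟ j
  ... | yes _ = 0≤a
  ... | no _  = 0≤1

  oneExcept≤1 : ∀ {k a} → a ≤ 1# → (i j : Fin k) → oneExcept a i j ≤ 1#
  oneExcept≤1 a≤1 i j with i ≟ j
  ... | yes _ = a≤1
  ... | no _  = ≤.refl

  oneExcept-mono-≤ : ∀ {k a b} → a ≤ b → (i j : Fin k) → oneExcept a i j ≤ oneExcept b i j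
  oneExcept-mono-≤ a≤b i j with i ≟ j
  ... | yes _ = a≤b
  ... | no _  = ≤.refl

  oneExcept-≡ : ∀ {k} a (i : Fin k) → oneExcept a i i ≡ a
  oneExcept-≡ a i with i ≟ i
  ... | yes _  = ≡.refl
  ... | no i≢i = ⊥-elim (i≢i ≡.refl)

  oneExcept-≢ : ∀ {k} a {i j : Fin k} → i ≢ j → oneExcept a i j ≡ 1#
  oneExcept-≢ a {i} {j} i≢j with i ≟ j
  ... | yes i≡j = ⊥-elim (i≢j i≡j)
  ... | no _    = ≡.refl

  -- From MinECC solutions to multiway cuts

  module _ (H : Hypergraph K) where
    open Hypergraph H

    toMultiwayCut : MinECCSolution K H → MultiwayCutSolution K H
    toMultiwayCut x = record
      { d = λ { (terminal _) → 0# ; (node _) → 0# ; (edgeNode e) → xₑ e }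
      ; y = λ { (terminal i) → oneExcept 0# i
              ; (node v)     → xᵥ v
              ; (edgeNode e) → oneExcept (xₑ e) (colour e) }
      }
      where open MinECCSolution x

    -- The node sums of MinECC enter only through the last hypothesis.
    toMultiwayCut-feasible : (x : MinECCSolution K H) → let open MinECCSolution x in
      (∀ v i → 0# ≤ xᵥ v i) → (∀ v i → xᵥ v i ≤ 1#) → (∀ e → 0# ≤ xₑ e) →
      (∀ e v → v ∈ edge e → xᵥ v (colour e) ≤ xₑ e) →
      (∀ e v → v ∈ edge e → ∀ i → colour e ≢ i → 1# ≤ xᵥ v i + xₑ e) →
      MultiwayCutFeasible K H (toMultiwayCut x)
    toMultiwayCut-feasible x 0≤xᵥ xᵥ≤1 0≤xₑ xᵥ≤xₑ 1≤xᵥ+xₑ = record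
      { d-nonNeg       = λ { (terminal _) → ≤.refl ; (node _) → ≤.refl ; (edgeNode e) → 0≤xₑ e }
      ; d-terminal     = λ _ → refl
      ; d-node         = λ _ → refl
      ; forward        = λ { _ _ (node-edge e v v∈e) → forward-node e v v∈e
                           ; _ _ (terminal-edge e)   → forward-terminal e }
      -- Backward constraints add `d` of a node or terminal, which is 0 here, so a plain comparison
      -- of labels suffices.
      ; backward       = λ { _ _ (node-edge e v v∈e) i → ≤.trans (backward-node e v v∈e i) (x≤x+y _ ≤.refl)
                           ; _ _ (terminal-edge e) i   → ≤.trans (oneExcept-mono-≤ (0≤xₑ e) (colour e) i)
                                                                 (x≤x+y _ ≤.refl) }
      ; own-terminal   = λ i → reflexive (oneExcept-≡ 0# i)
      ; other-terminal = λ i j i≢j → ≤.reflexive (reflexive (≡.sym (oneExcept-≢ 0# i≢j)))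
      }
      where
      open MinECCSolution x
      forward-node : ∀ e v → v ∈ edge e → ∀ i → oneExcept (xₑ e) (colour e) i ≤ xᵥ v i + xₑ e
      forward-node e v v∈e i with colour e ≟ i
      ... | yes _ = x≤y+x (xₑ e) (0≤xᵥ v i)
      ... | no ≢i = 1≤xᵥ+xₑ e v v∈e i ≢i
      forward-terminal : ∀ e i → oneExcept (xₑ e) (colour e) i ≤ oneExcept 0# (colour e) i + xₑ e
      forward-terminal e i with colour e ≟ i
      -- At the colour of `e` the terminal label is 0 and the bound is tight; at any other colour
      -- both labels are 1.
      ... | yes _ = x≤y+x (xₑ e) ≤.refl
      ... | no _  = x≤x+y 1# (0≤xₑ e)
      backward-node : ∀ e v → v ∈ edge e → ∀ i → xᵥ v i ≤ oneExcept (xₑ e) (colour e) i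
      backward-node e v v∈e i with colour e ≟ i
      ... | yes ≡.refl = xᵥ≤xₑ e v v∈e
      ... | no _       = xᵥ≤1 v i

    MinECCFeasible⇒MultiwayCutFeasible : ∀ {x} → MinECCFeasible K H x → MultiwayCutFeasible K H (toMultiwayCut x)
    MinECCFeasible⇒MultiwayCutFeasible {x} feasible =
      toMultiwayCut-feasible x 0≤xᵥ xᵥ≤1 0≤xₑ edge-node λ e v v∈e i ≢i → begin
        1#                         ≤⟨ sum≈k-1⇒1≤pair (xᵥ≤1 v) (node-sum v) (≢i ∘ ≡.sym) ⟩
        xᵥ v i + xᵥ v (colour e)   ≤⟨ +-monoʳ-≤ (xᵥ v i) (edge-node e v v∈e) ⟩
        xᵥ v i + xₑ e              ∎
      where
      open MinECCSolution x
      open MinECCFeasible feasible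

    MultiwayCut≤MinECC : ∀ a b → IsOptimalValue K (MultiwayCut-LP K H) a →
                         IsOptimalValue K (MinECC-LP K H) b → a ≤ b
    MultiwayCut≤MinECC a b cut ecc with IsOptimalValue.attained ecc
    -- The cut built from an optimal `x` has the same objective by computation, since its `d` on
    -- edge nodes is `xₑ`.
    ... | x , feasible , objective≈b = ≤.≤-respʳ-≈ objective≈b
      (IsOptimalValue.lowerBound cut (toMultiwayCut x) (MinECCFeasible⇒MultiwayCutFeasible feasible))

  -- The star with three edges

  centre∈ : ∀ e → zero ∈ Hypergraph.edge (star K) e
  centre∈ e = p⊆p∪q ⁅ suc e ⁆ (x∈⁅x⁆ zero)

  -- The centre lies in every edge and edge `e` has colour `e`, so the three edge variables dominate
  -- the centre's coordinates, whose sum is 3 - 1 = 2.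
  star-MinECC : IsOptimalValue K (MinECC-LP K (star K)) (fromℕ 2)
  star-MinECC = record
    { attained   = x , feasible , solve 1 (λ o → o :* con 0 :+ (o :* con 1 :+ (o :* con 1 :+ con 0))
                                                 := o :+ (o :+ con 0)) refl 1#
    ; lowerBound = lowerBound
    }
    where
    -- An integral optimum: each leaf takes the colour of its edge and the centre takes colour
    -- `zero`, so edge `zero` costs 0 and the other two cost 1 each.
    label : Fin 4 → Fin 3
    label zero    = zero
    label (suc i) = i

    x : MinECCSolution K (star K)
    x = record { xᵥ = λ v → oneExcept 0# (label v) ; xₑ = oneExcept 0# zero }

    3-1≈2 : fromℕ 3 - 1# ≈ fromℕ 2
    3-1≈2 = sym (x≈z//y (fromℕ 2) 1# (fromℕ 3) (+-comm (fromℕ 2) 1#))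

    sum-oneExcept : (i : Fin 3) → sum (oneExcept 0# i) ≈ fromℕ 2
    sum-oneExcept zero             = +-identityˡ _
    sum-oneExcept (suc zero)       = +-congˡ (+-identityˡ _)
    sum-oneExcept (suc (suc zero)) = +-congˡ (+-congˡ (+-identityˡ _))

    xᵥ≤xₑ : ∀ e v → v ∈ Hypergraph.edge (star K) e → oneExcept 0# (label v) e ≤ oneExcept 0# zero e
    xᵥ≤xₑ e v v∈e with x∈p∪q⁻ ⁅ zero ⁆ ⁅ suc e ⁆ v∈e
    ... | inj₁ v∈₀ with ≡.refl ← x∈⁅y⁆⇒x≡y zero v∈₀ = ≤.refl
    -- The leaf of `e` has colour `e`, so its coordinate there is 0; at the centre, handled above,
    -- both sides coincide.
    ... | inj₂ v∈ₑ with ≡.refl ← x∈⁅y⁆⇒x≡y (suc e) v∈ₑ =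
      ≤.trans (≤.reflexive (reflexive (oneExcept-≡ 0# e))) (0≤oneExcept ≤.refl zero e)

    feasible : MinECCFeasible K (star K) x
    feasible = record
      { node-sum  = λ v → trans (sum-oneExcept (label v)) (sym 3-1≈2)
      ; edge-node = xᵥ≤xₑ
      ; 0≤xᵥ      = λ v → 0≤oneExcept ≤.refl (label v)
      ; xᵥ≤1      = λ v → oneExcept≤1 0≤1 (label v)
      ; 0≤xₑ      = 0≤oneExcept ≤.refl zero
      ; xₑ≤1      = oneExcept≤1 0≤1 zero
      }

    lowerBound : ∀ s → MinECCFeasible K (star K) s →
                 fromℕ 2 ≤ sum (λ e → 1# * MinECCSolution.xₑ s e)
    lowerBound s feasible = begin
      fromℕ 2                  ≈⟨ 3-1≈2 ⟨
      fromℕ 3 - 1#             ≈⟨ node-sum zero ⟨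
      sum (xᵥ zero)            ≤⟨ sum-mono-≤ (λ e → edge-node e zero (centre∈ e)) ⟩
      sum xₑ                   ≈⟨ sum-cong-≋ (λ e → *-identityˡ (xₑ e)) ⟨
      sum (λ e → 1# * xₑ e)    ∎
      where
      open MinECCSolution s
      open MinECCFeasible feasible

  -- Each of the three pairs of terminals forces its two edge nodes to have total `d` at least 1.
  -- Adding the three bounds counts every edge node twice, so halving yields 3/2, which the all-½
  -- point attains.
  star-MultiwayCut : IsOptimalValue K (MultiwayCut-LP K (star K)) (fromℕ 3 * ½)
  star-MultiwayCut = record
    { attained   = toMultiwayCut (star K) x
                 , toMultiwayCut-feasible (star K) x (λ _ _ → 0≤½) (λ _ _ → ½≤1) (λ _ → 0≤½)
                     -- At this point `xᵥ ≤ xₑ` reads ½ ≤ ½ and `1# ≤ xᵥ + xₑ` reads 1 ≤ ½ + ½, both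
                     -- tight.
                     (λ _ _ _ → ≤.refl) (λ _ _ _ _ _ → ≤.reflexive (sym ½+½≈1))
                 , solve 2 (λ o h → o :* h :+ (o :* h :+ (o :* h :+ con 0))
                                    := (o :+ (o :+ (o :+ con 0))) :* h) refl 1# ½
    ; lowerBound = lowerBound
    }
    where
    x : MinECCSolution K (star K)
    x = record { xᵥ = λ _ _ → ½ ; xₑ = λ _ → ½ }

    lowerBound : ∀ s → MultiwayCutFeasible K (star K) s →
                 fromℕ 3 * ½ ≤ sum (λ e → 1# * MultiwayCutSolution.d s (edgeNode e))
    lowerBound s feasible = begin
      -- `fromℕ 3` unfolds to 1 + (1 + (1 + 0)), with one summand for each pair of edges; this
      -- explains the nesting and the trailing `0#`.
      fromℕ 3 * ½                                ≤⟨ *-monoʳ-≤-nonNeg 0≤½ (+-mono-≤ (1≤dᵢ+dⱼ zero (suc zero) λ ())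
                                                      (+-mono-≤ (1≤dᵢ+dⱼ zero (suc (suc zero)) λ ())
                                                      (+-monoˡ-≤ 0# (1≤dᵢ+dⱼ (suc zero) (suc (suc zero)) λ ())))) ⟩
      (d₀ + d₁ + (d₀ + d₂ + (d₁ + d₂ + 0#))) * ½   ≈⟨ solve 4 (λ a b c h →
                                                      (a :+ b :+ (a :+ c :+ (b :+ c :+ con 0))) :* h
                                                      := (h :+ h) :* a :+ ((h :+ h) :* b :+ ((h :+ h) :* c :+ con 0)))
                                                      refl d₀ d₁ d₂ ½ ⟩
      sum (λ e → (½ + ½) * d (edgeNode e))       ≈⟨ sum-cong-≋ (λ e → *-congʳ {d (edgeNode e)} ½+½≈1) ⟩
      sum (λ e → 1# * d (edgeNode e))            ∎
      where
      open MultiwayCutSolution s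
      open MultiwayCutFeasible feasible
      d₀ = d (edgeNode zero)
      d₁ = d (edgeNode (suc zero))
      d₂ = d (edgeNode (suc (suc zero)))

      -- The labels along the path tⱼ, vₑⱼ, v₀, vₑᵢ, tᵢ.
      1≤dᵢ+dⱼ : ∀ i j → i ≢ j → 1# ≤ d (edgeNode i) + d (edgeNode j)
      1≤dᵢ+dⱼ i j i≢j = begin
        1#                                                 ≤⟨ other-terminal j i (i≢j ∘ ≡.sym) ⟩
        y (terminal j) i                                   ≤⟨ backward _ _ (terminal-edge j) i ⟩
        y (edgeNode j) i + d (terminal j)                  ≈⟨ trans (+-congˡ (d-terminal j)) (+-identityʳ _) ⟩
        y (edgeNode j) i                                   ≤⟨ forward _ _ (node-edge j zero (centre∈ j)) i ⟩
        y (node zero) i + dⱼ                               ≤⟨ +-monoˡ-≤ dⱼ (backward _ _ (node-edge i zero (centre∈ i)) i) ⟩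
        y (edgeNode i) i + d (node zero) + dⱼ              ≈⟨ +-congʳ (trans (+-congˡ (d-node zero)) (+-identityʳ _)) ⟩
        y (edgeNode i) i + dⱼ                              ≤⟨ +-monoˡ-≤ dⱼ (forward _ _ (terminal-edge i) i) ⟩
        y (terminal i) i + d (edgeNode i) + dⱼ             ≈⟨ +-congʳ (trans (+-congʳ (own-terminal i)) (+-identityˡ _)) ⟩
        d (edgeNode i) + dⱼ                                ∎
        where dⱼ = d (edgeNode j)

theorem1 : ∀ {c ℓ₁ ℓ₂ : Level} (K : OrderedField c ℓ₁ ℓ₂) →
    let open OrderedField K in
    (∀ (H : Hypergraph K) a b →
    IsOptimalValue K (MultiwayCut-LP K H) a →
    IsOptimalValue K (MinECC-LP K H) b →
    a ≤ b)
    × IsOptimalValue K (MinECC-LP K (star K)) (fromℕ 2)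
    × IsOptimalValue K (MultiwayCut-LP K (star K)) (fromℕ 3 * ½)
    × fromℕ 3 * ½ < fromℕ 2
theorem1 K = MultiwayCut≤MinECC K , star-MinECC K , star-MultiwayCut K , 3*½<2 K
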